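{- For integers $a \geq 3$ and $n \ge a$, the function $\mathrm{gex}(n;a)$ is bounded above in terms of the Ramsey number $R(a,a+1)$ by $$\mathrm{gex}(n;a) \leq \frac{R(a,a+1)-1}{2}\, n.$$
   Context: All graphs are finite, simple and undirected; the order of a graph is its number of vertices and its size is its number of edges. A geodesic is a shortest path between two vertices. A set $S$ of vertices of a graph $G$ is in general position if no geodesic of $G$ contains more than two elements of $S$; the general position number (gp-number) is the largest size of such a set. For $a \geq 2$ and $n \geq a$, $\mathrm{gex}(n;a)$ is the largest possible size of a graph with order $n$ and gp-number $a$. The Ramsey number $R(s,t)$ is the smallest $N$ such that every graph of order $N$ contains a clique of size $s$ or an independent set of size $t$. -}

module Defs where

open import Data.Fin using (Fin; _<?_)
open import Data.Fin.Subset using (Subset; _∈_; _∩_; ⋃; ⁅_⁆; ∣_∣)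
open import Data.List using (List; []; _∷_; map; filter; length; allFin; cartesianProduct)
open import Data.List.Relation.Unary.Unique.Propositional using (Unique)
open import Data.Nat using (ℕ; zero; suc; _≤_)
open import Data.Product using (∃; _×_; _,_)
open import Data.Sum using (_⊎_)
open import Level using (Level; 0ℓ)
open import Relation.Binary using (Rel; Decidable; Symmetric; Irreflexive)
open import Relation.Binary.Construct.Closure.ReflexiveTransitive using (Star; ε; _◅_)
open import Relation.Binary.PropositionalEquality using (_≡_; _≢_)
open import Relation.Nullary using (¬_)
open import Relation.Nullary.Decidable using (_×-dec_)

IsLargest : ∀ {ℓ : Level} → (ℕ → Set ℓ) → ℕ → Set ℓ
IsLargest P m = P m × (∀ k → P k → k ≤ m)

IsSmallest : ∀ {ℓ : Level} → (ℕ → Set ℓ) → ℕ → Set ℓ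
IsSmallest P m = P m × (∀ k → P k → m ≤ k)

-- Adjacency is required to be decidable, so that edges can be counted.
-- Graphs need not be connected.
record Graph (n : ℕ) : Set₁ where
  field
    Adj    : Rel (Fin n) 0ℓ
    adj?   : Decidable Adj
    sym    : Symmetric Adj
    irrefl : Irreflexive _≡_ Adj

module _ {n : ℕ} (G : Graph n) where
  open Graph G

  -- Each edge is counted once, by its endpoints in increasing order.
  size : ℕ
  size = length (filter (λ (i , j) → (i <? j) ×-dec adj? i j)
                        (cartesianProduct (allFin n) (allFin n)))

  Walk : Rel (Fin n) 0ℓ
  Walk = Star Adj

  vertices : ∀ {u v} → Walk u v → List (Fin n)
  vertices {u} ε       = u ∷ []
  vertices {u} (_ ◅ w) = u ∷ vertices w

  walkLength : ∀ {u v} → Walk u v → ℕ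
  walkLength ε       = zero
  walkLength (_ ◅ w) = suc (walkLength w)

  IsPath : ∀ {u v} → Walk u v → Set
  IsPath w = Unique (vertices w)

  IsGeodesic : ∀ {u v} → Walk u v → Set
  IsGeodesic {u} {v} w =
    IsPath w × (∀ (w′ : Walk u v) → IsPath w′ → walkLength w ≤ walkLength w′)

  vertexSet : ∀ {u v} → Walk u v → Subset n
  vertexSet w = ⋃ (map ⁅_⁆ (vertices w))

  InGeneralPosition : Subset n → Set
  InGeneralPosition S =
    ∀ {u v} (w : Walk u v) → IsGeodesic w → ∣ S ∩ vertexSet w ∣ ≤ 2

  IsGPNumber : ℕ → Set
  IsGPNumber = IsLargest λ k → ∃ λ S → ∣ S ∣ ≡ k × InGeneralPosition S

  IsClique : Subset n → Set
  IsClique S = ∀ {u v} → u ∈ S → v ∈ S → u ≢ v → Adj u v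

  IsIndependent : Subset n → Set
  IsIndependent S = ∀ {u v} → u ∈ S → v ∈ S → ¬ Adj u v

-- IsGex n a m states that m is the value gex(n;a).
IsGex : ℕ → ℕ → ℕ → Set₁
IsGex n a = IsLargest λ m → ∃ λ (G : Graph n) → IsGPNumber G a × size G ≡ m

-- IsRamseyNumber s t r states that r is the value R(s,t).
IsRamseyNumber : ℕ → ℕ → ℕ → Set₁
IsRamseyNumber s t = IsSmallest λ N → ∀ (G : Graph N) →
  (∃ λ S → ∣ S ∣ ≡ s × IsClique G S) ⊎ (∃ λ S → ∣ S ∣ ≡ t × IsIndependent G S)

{-# OPTIONS --safe #-}

-- If some vertex had R(a,a+1) neighbours, they would contain a clique of order a,
-- which together with the vertex is a clique of order a+1, or an independent set of
-- order a+1. Either one is in general position: a geodesic meeting it in x, y, z, in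
-- this order, would be shortened by the edge xz in the first case, and by passing from
-- x to z through the common neighbour in the second, where its part from x to z
-- has length at least 4. So all degrees are at most R(a,a+1) - 1, and the bound follows
-- from the handshake lemma.
module Submission where

open import Defs
open import Data.Nat using (ℕ; _≤_; _+_)
open import Data.Integer using (+_; 1ℤ; _-_)
open import Data.Rational using (_/_) renaming (_≤_ to _≤ℚ_; _*_ to _*ℚ_)

open import Data.Nat.Properties as ℕ hiding (_≟_; _<?_; <-asym)
open import Algebra.Properties.CommutativeSemigroup ℕ.+-commutativeSemigroup
  using (interchange; x∙yz≈y∙xz)
open import Data.Bool using (true; false)
open import Data.Fin as Fin using (Fin; zero; suc; _≟_; _<?_)
open import Data.Fin.Properties using (<-asym)
open import Data.Fin.Subset
  using (Subset; inside; outside; _∈_; _∉_; _⊆_; _∩_; _∪_; ⊥; ⁅_⁆; ∣_∣)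
open import Data.Fin.Subset.Properties
import Data.Integer as ℤ
import Data.Integer.Properties as ℤ
open import Data.List as List using (List; []; _∷_; _++_; length; filter; allFin; cartesianProduct)
open import Data.List.Properties using (length-++; length-tabulate; filter-++)
open import Data.List.Membership.Propositional using () renaming (_∈_ to _∈ˡ_)
open import Data.List.Membership.DecPropositional using () renaming (_∈?_ to mem?)
open import Data.List.Relation.Unary.All using ([])
open import Data.List.Relation.Unary.All.Properties using (¬Any⇒All¬)
open import Data.List.Relation.Unary.AllPairs using ([]; _∷_)
open import Data.List.Relation.Unary.Any using (here; there)
open import Data.Nat using (zero; suc; _*_; _<_; z≤n; s≤s; s≤s⁻¹; z<s)
open import Data.Nat.ListAction using (sum)
open import Data.Product using (∃; Σ-syntax; _×_; _,_; proj₂)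
open import Data.Rational.Properties using (toℚᵘ-cancel-≤; toℚᵘ-fromℚᵘ; toℚᵘ-homo-*)
open import Data.Rational.Unnormalised as ℚᵘ using (mkℚᵘ; *≤*)
import Data.Rational as ℚ
import Data.Rational.Unnormalised.Properties as ℚᵘ
open import Data.Sum using (inj₁; inj₂)
open import Data.Vec as Vec using ([]; _∷_; here; there)
open import Data.Vec.Properties using (lookup∘tabulate; []=⇒lookup)
open import Function using (_∘_; id; flip)
open import Level using (Level)
open import Relation.Binary.Construct.Closure.ReflexiveTransitive using (ε; _◅_; _◅◅_)
open import Relation.Binary.Construct.Closure.ReflexiveTransitive.Properties using (◅◅-assoc)
open import Relation.Binary.PropositionalEquality
  using (_≡_; refl; sym; trans; cong; cong₂; subst; module ≡-Reasoning)
open import Relation.Nullary using (¬_; yes; no; does; contradiction)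
open import Relation.Nullary.Decidable using (_×-dec_)
import Relation.Unary as U

private variable
  ℓ ℓ′ : Level
  A B : Set ℓ
  n k : ℕ

-- Finite subsets

∣⁅x⁆∪p∣≤1+∣p∣ : ∀ (x : Fin n) p → ∣ ⁅ x ⁆ ∪ p ∣ ≤ suc ∣ p ∣
∣⁅x⁆∪p∣≤1+∣p∣ zero (inside ∷ p) = s≤s (≤-trans (≤-reflexive (cong ∣_∣ (∪-identityˡ p))) (n≤1+n _))
∣⁅x⁆∪p∣≤1+∣p∣ zero (outside ∷ p) = s≤s (≤-reflexive (cong ∣_∣ (∪-identityˡ p)))
∣⁅x⁆∪p∣≤1+∣p∣ (suc x) (inside ∷ p) = s≤s (∣⁅x⁆∪p∣≤1+∣p∣ x p)
∣⁅x⁆∪p∣≤1+∣p∣ (suc x) (outside ∷ p) = ∣⁅x⁆∪p∣≤1+∣p∣ x p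

x∉p⇒∣p∣<∣⁅x⁆∪p∣ : ∀ {x : Fin n} {p} → x ∉ p → ∣ p ∣ < ∣ ⁅ x ⁆ ∪ p ∣
x∉p⇒∣p∣<∣⁅x⁆∪p∣ {x = x} {p} x∉p =
  p⊂q⇒∣p∣<∣q∣ (q⊆p∪q ⁅ x ⁆ p , x , x∈p∪q⁺ (inj₁ (x∈⁅x⁆ x)) , x∉p)

∣p∩[⁅x⁆∪q]∣≤1+∣p∩q∣ : ∀ (x : Fin n) p q → ∣ p ∩ (⁅ x ⁆ ∪ q) ∣ ≤ suc ∣ p ∩ q ∣
∣p∩[⁅x⁆∪q]∣≤1+∣p∩q∣ x p q = ≤-trans (p⊆q⇒∣p∣≤∣q∣ incl) (∣⁅x⁆∪p∣≤1+∣p∣ x (p ∩ q))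
  where
  incl : p ∩ (⁅ x ⁆ ∪ q) ⊆ ⁅ x ⁆ ∪ (p ∩ q)
  incl y∈ with y∈p , y∈∪ ← x∈p∩q⁻ p _ y∈ | x∈p∪q⁻ ⁅ x ⁆ q y∈∪
  ... | inj₁ y∈x = x∈p∪q⁺ (inj₁ y∈x)
  ... | inj₂ y∈q = x∈p∪q⁺ (inj₂ (x∈p∩q⁺ (y∈p , y∈q)))

x∉p⇒∣p∩[⁅x⁆∪q]∣≤∣p∩q∣ : ∀ {x : Fin n} {p} q → x ∉ p → ∣ p ∩ (⁅ x ⁆ ∪ q) ∣ ≤ ∣ p ∩ q ∣
x∉p⇒∣p∩[⁅x⁆∪q]∣≤∣p∩q∣ {x = x} {p} q x∉p = p⊆q⇒∣p∣≤∣q∣ incl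
  where
  incl : p ∩ (⁅ x ⁆ ∪ q) ⊆ p ∩ q
  incl y∈ with y∈p , y∈∪ ← x∈p∩q⁻ p _ y∈ | x∈p∪q⁻ ⁅ x ⁆ q y∈∪
  ... | inj₁ y∈x = contradiction (subst (_∈ p) (x∈⁅y⁆⇒x≡y x y∈x) y∈p) x∉p
  ... | inj₂ y∈q = x∈p∩q⁺ (y∈p , y∈q)

-- The Ramsey property concerns graphs of order exactly `R`, so a larger neighbourhood has to be cut
-- down to `R` vertices.
subset-of-size : ∀ k (p : Subset n) → k ≤ ∣ p ∣ → Σ[ q ∈ Subset n ] q ⊆ p × ∣ q ∣ ≡ k
subset-of-size {n = n} zero p _ = ⊥ , ⊥⊆ , ∣⊥∣≡0 n
subset-of-size (suc k) (outside ∷ p) k< =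
  let q , q⊆p , ∣q∣≡k = subset-of-size (suc k) p k< in outside ∷ q , s⊆s q⊆p , ∣q∣≡k
subset-of-size (suc k) (inside ∷ p) (s≤s k≤) =
  let q , q⊆p , ∣q∣≡k = subset-of-size k p k≤ in inside ∷ q , s⊆s q⊆p , cong suc ∣q∣≡k

element : ∀ (p : Subset n) → Fin ∣ p ∣ → Fin n
element (outside ∷ p) i       = suc (element p i)
element (inside  ∷ p) zero    = zero
element (inside  ∷ p) (suc i) = suc (element p i)

element-∈ : ∀ (p : Subset n) i → element p i ∈ p
element-∈ (outside ∷ p) i       = there (element-∈ p i)
element-∈ (inside  ∷ p) zero    = here
element-∈ (inside  ∷ p) (suc i) = there (element-∈ p i)

-- The image of `s` under `element p`, obtained by writing the entries of `s` into the inside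
-- positions of `p`; its cardinality then follows by direct induction.
image : ∀ (p : Subset n) → Subset ∣ p ∣ → Subset n
image []            s       = []
image (outside ∷ p) s       = outside ∷ image p s
image (inside  ∷ p) (b ∷ s) = b ∷ image p s

∣image∣ : ∀ (p : Subset n) s → ∣ image p s ∣ ≡ ∣ s ∣
∣image∣ []            []            = refl
∣image∣ (outside ∷ p) s             = ∣image∣ p s
∣image∣ (inside  ∷ p) (inside  ∷ s) = cong suc (∣image∣ p s)
∣image∣ (inside  ∷ p) (outside ∷ s) = ∣image∣ p s

∈-image⁻ : ∀ (p : Subset n) s {x} → x ∈ image p s → ∃ λ i → i ∈ s × element p i ≡ x
∈-image⁻ (outside ∷ p) s (there x∈) =
  let i , i∈s , eq = ∈-image⁻ p s x∈ in i , i∈s , cong suc eq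
∈-image⁻ (inside ∷ p) (inside ∷ s) here = zero , here , refl
∈-image⁻ (inside ∷ p) (b ∷ s) (there x∈) =
  let i , i∈s , eq = ∈-image⁻ p s x∈ in suc i , there i∈s , cong suc eq

image⊆ : ∀ (p : Subset n) s → image p s ⊆ p
image⊆ p s x∈ with i , _ , refl ← ∈-image⁻ p s x∈ = element-∈ p i

-- Connects degrees, which are cardinalities of tabulated subsets, with the filtered lists that
-- count edges.
∣tabulate∣ : ∀ {P : U.Pred A ℓ} (P? : U.Decidable P) (f : Fin n → A) →
             ∣ Vec.tabulate (does ∘ P? ∘ f) ∣ ≡ length (filter P? (List.tabulate f))
∣tabulate∣ {n = zero}  P? f = refl
∣tabulate∣ {n = suc n} P? f with does (P? (f zero))
... | true  = cong suc (∣tabulate∣ P? (f ∘ suc))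
... | false = ∣tabulate∣ P? (f ∘ suc)

-- Counting pairs

length-filter-map : ∀ {P : U.Pred B ℓ} (P? : U.Decidable P) (f : A → B) xs →
                    length (filter P? (List.map f xs)) ≡ length (filter (P? ∘ f) xs)
length-filter-map P? f [] = refl
length-filter-map P? f (x ∷ xs) with does (P? (f x))
... | true  = cong suc (length-filter-map P? f xs)
... | false = length-filter-map P? f xs

length-filter-disjoint : ∀ {P Q R : U.Pred A ℓ}
  (P? : U.Decidable P) (Q? : U.Decidable Q) (R? : U.Decidable R) →
  P U.⊆ R → Q U.⊆ R → (∀ {x} → P x → ¬ Q x) → ∀ xs →
  length (filter P? xs) + length (filter Q? xs) ≤ length (filter R? xs)
length-filter-disjoint P? Q? R? P⊆R Q⊆R P∩Q=∅ [] = z≤n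
length-filter-disjoint P? Q? R? P⊆R Q⊆R P∩Q=∅ (x ∷ xs)
  with ih ← length-filter-disjoint P? Q? R? P⊆R Q⊆R P∩Q=∅ xs | P? x | Q? x | R? x
... | yes p | yes q | _     = contradiction q (P∩Q=∅ p)
... | yes p | no _  | yes _ = s≤s ih
... | yes p | no _  | no ¬r = contradiction (P⊆R p) ¬r
... | no _  | yes q | yes _ = ≤-trans (≤-reflexive (+-suc _ _)) (s≤s ih)
... | no _  | yes q | no ¬r = contradiction (Q⊆R q) ¬r
... | no _  | no _  | yes _ = m≤n⇒m≤1+n ih
... | no _  | no _  | no _  = ih

module _ {A : Set ℓ} {B : Set ℓ′} where

  #related : ∀ {R : A → B → Set} → (∀ x → U.Decidable (R x)) → List B → A → ℕ
  #related R? ys x = length (filter (R? x) ys)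

  length-filter-cartesianProduct : ∀ {R : A → B → Set} (R? : ∀ x → U.Decidable (R x)) xs ys →
    length (filter (λ (x , y) → R? x y) (cartesianProduct xs ys)) ≡
    sum (List.map (#related R? ys) xs)
  length-filter-cartesianProduct R? [] ys = refl
  length-filter-cartesianProduct R? (x ∷ xs) ys = begin
    length (filter R?′ (List.map (x ,_) ys ++ cartesianProduct xs ys))
      ≡⟨ cong length (filter-++ R?′ (List.map (x ,_) ys) _) ⟩
    length (filter R?′ (List.map (x ,_) ys) ++ filter R?′ (cartesianProduct xs ys))
      ≡⟨ length-++ (filter R?′ (List.map (x ,_) ys)) ⟩
    length (filter R?′ (List.map (x ,_) ys)) + length (filter R?′ (cartesianProduct xs ys))
      ≡⟨ cong₂ _+_ (length-filter-map R?′ (x ,_) ys) (length-filter-cartesianProduct R? xs ys) ⟩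
    #related R? ys x + sum (List.map (#related R? ys) xs) ∎
    where
    open ≡-Reasoning
    R?′ = λ ((x , y) : A × B) → R? x y

-- Double counting by rows and by columns. The induction takes off one row `x`, and `add-row`
-- distributes its entries over the columns.
sum-related-flip :
  ∀ {A : Set ℓ} {B : Set ℓ′} {R : A → B → Set} (R? : ∀ x → U.Decidable (R x)) xs ys →
  sum (List.map (#related R? ys) xs) ≡ sum (List.map (#related (flip R?) xs) ys)
sum-related-flip R? [] [] = refl
sum-related-flip R? [] (y ∷ ys) = sum-related-flip R? [] ys
sum-related-flip R? (x ∷ xs) ys =
  trans (cong₂ _+_ refl (sum-related-flip R? xs ys)) (add-row ys)
  where
  add-row : ∀ ys → #related R? ys x + sum (List.map (#related (flip R?) xs) ys) ≡
                   sum (List.map (#related (flip R?) (x ∷ xs)) ys)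
  add-row [] = refl
  add-row (y ∷ ys) with eq ← trans (x∙yz≈y∙xz (#related R? ys x) (#related (flip R?) xs y) _)
                                   (cong₂ _+_ refl (add-row ys))
                      | does (R? x y)
  ... | true  = cong suc eq
  ... | false = eq

sum-map-+ : ∀ (f g : A → ℕ) xs →
  sum (List.map f xs) + sum (List.map g xs) ≡ sum (List.map (λ x → f x + g x) xs)
sum-map-+ f g [] = refl
sum-map-+ f g (x ∷ xs) =
  trans (interchange (f x) _ (g x) _) (cong₂ _+_ refl (sum-map-+ f g xs))

sum-map-≤ : ∀ {f : A → ℕ} {c} → (∀ x → f x ≤ c) → ∀ xs → sum (List.map f xs) ≤ length xs * c
sum-map-≤ f≤c []       = z≤n
sum-map-≤ f≤c (x ∷ xs) = +-mono-≤ (f≤c x) (sum-map-≤ f≤c xs)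

-- Walks and general position

module _ {n : ℕ} (G : Graph n) where
  open Graph G renaming (sym to Adj-sym)

  walkLength-◅◅ : ∀ {u v w} (p : Walk G u v) (q : Walk G v w) →
                  walkLength G (p ◅◅ q) ≡ walkLength G p + walkLength G q
  walkLength-◅◅ ε       q = refl
  walkLength-◅◅ (_ ◅ p) q = cong suc (walkLength-◅◅ p q)

  path-suffix : ∀ {u v x} (p : Walk G u v) → IsPath G p → x ∈ˡ vertices G p →
                Σ[ q ∈ Walk G x v ] IsPath G q × walkLength G q ≤ walkLength G p
  path-suffix ε       path       (here refl) = ε , path , z≤n
  path-suffix (e ◅ p) path       (here refl) = e ◅ p , path , ≤-refl
  path-suffix (_ ◅ p) (_ ∷ path) (there x∈p) =
    let q , q-path , q≤p = path-suffix p path x∈p in q , q-path , m≤n⇒m≤1+n q≤p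

  -- Loop erasure: if `u` already lies on the path found for the rest, the part of that path from
  -- `u` onwards is taken instead of prepending `u`.
  walk⇒path : ∀ {u v} (p : Walk G u v) →
              Σ[ q ∈ Walk G u v ] IsPath G q × walkLength G q ≤ walkLength G p
  walk⇒path ε = ε , [] ∷ [] , z≤n
  walk⇒path {u} (e ◅ p) with q , q-path , q≤p ← walk⇒path p | mem? _≟_ u (vertices G q)
  ... | yes u∈q = let r , r-path , r≤q = path-suffix q q-path u∈q
                  in r , r-path , m≤n⇒m≤1+n (≤-trans r≤q q≤p)
  ... | no u∉q  = e ◅ q , ¬Any⇒All¬ _ u∉q ∷ q-path , s≤s q≤p

  -- `IsGeodesic` compares with paths only, whereas a shortcut spliced into a geodesic may repeat
  -- vertices; loop erasure covers these walks too.
  geodesic-shortest : ∀ {u v} {p : Walk G u v} → IsGeodesic G p →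
                      ∀ q → walkLength G p ≤ walkLength G q
  geodesic-shortest (_ , shortest) q =
    let q′ , q′-path , q′≤q = walk⇒path q in ≤-trans (shortest q′ q′-path) q′≤q

  -- Exchanging `q` for `q′` keeps the ends of the whole walk, and the lengths of `p` and `r`
  -- cancel.
  geodesic-segment-shortest : ∀ {u x y v} (p : Walk G u x) (q : Walk G x y) (r : Walk G y v) →
    IsGeodesic G (p ◅◅ q ◅◅ r) → ∀ q′ → walkLength G q ≤ walkLength G q′
  geodesic-segment-shortest p q r geodesic q′ =
    +-cancelʳ-≤ (walkLength G r) _ _ (+-cancelˡ-≤ (walkLength G p) _ _ (begin
      walkLength G p + (walkLength G q + walkLength G r)  ≡⟨ split q ⟨
      walkLength G (p ◅◅ q ◅◅ r)                          ≤⟨ geodesic-shortest geodesic (p ◅◅ q′ ◅◅ r) ⟩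
      walkLength G (p ◅◅ q′ ◅◅ r)                         ≡⟨ split q′ ⟩
      walkLength G p + (walkLength G q′ + walkLength G r) ∎))
    where
    open ≤-Reasoning
    split : ∀ q → walkLength G (p ◅◅ q ◅◅ r) ≡ walkLength G p + (walkLength G q + walkLength G r)
    split q = trans (walkLength-◅◅ p (q ◅◅ r)) (cong₂ _+_ refl (walkLength-◅◅ q r))

  laterVertices : ∀ {u v} → Walk G u v → Subset n
  laterVertices ε       = ⊥
  laterVertices (_ ◅ p) = vertexSet G p

  vertexSet-unfold : ∀ {u v} (p : Walk G u v) → vertexSet G p ≡ ⁅ u ⁆ ∪ laterVertices p
  vertexSet-unfold ε       = refl
  vertexSet-unfold (_ ◅ _) = refl

  module _ (S : Subset n) where

    -- Indexed by the walk, so that matching on `visit` turns the walk itself into a concatenation;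
    -- `k` bounds from below the elements of `S` still to come.
    data FirstVisit {v} (k : ℕ) : ∀ {u} → Walk G u v → Set where
      visit : ∀ {u x} (p : Walk G u x) (q : Walk G x v) → x ∈ S →
              k ≤ ∣ S ∩ laterVertices q ∣ → FirstVisit k (p ◅◅ q)

    -- The explicit edge `e` forces progress: the vertex found is at a later position than the
    -- start.
    data NextVisit {v} (k : ℕ) : ∀ {u} → Walk G u v → Set where
      visit : ∀ {u y x} (e : Adj u y) (p : Walk G y x) (q : Walk G x v) → x ∈ S →
              k ≤ ∣ S ∩ laterVertices q ∣ → NextVisit k (e ◅ p ◅◅ q)

    -- The start of the walk accounts for at most one element of `S`, and for none if it lies
    -- outside `S`; so the strict bound leaves at least `k` after the vertex found.
    firstVisit : ∀ {u v} (p : Walk G u v) → k < ∣ S ∩ vertexSet G p ∣ → FirstVisit k p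
    nextVisit : ∀ {u v} (p : Walk G u v) → k < ∣ S ∩ laterVertices p ∣ → NextVisit k p

    firstVisit {u = u} p k<
      with k<′ ← subst (λ T → _ < ∣ S ∩ T ∣) (vertexSet-unfold p) k< | u ∈? S
    ... | yes u∈S =
      visit ε p u∈S (s≤s⁻¹ (≤-trans k<′ (∣p∩[⁅x⁆∪q]∣≤1+∣p∩q∣ u S (laterVertices p))))
    ... | no u∉S
      with visit e q r x∈S k≤ ←
        nextVisit p (≤-trans k<′ (x∉p⇒∣p∩[⁅x⁆∪q]∣≤∣p∩q∣ (laterVertices p) u∉S))
      = visit (e ◅ q) r x∈S k≤

    nextVisit ε k< =
      contradiction (≤-trans k< (≤-trans (∣p∩q∣≤∣q∣ S ⊥) (≤-reflexive (∣⊥∣≡0 n)))) n≮0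
    nextVisit (e ◅ p) k< with visit q r x∈S k≤ ← firstVisit p k< = visit e q r x∈S k≤

    -- The common form of the clique case and the independent case. The edges `e` and `f` make both
    -- halves of the walk through `y` nonempty.
    HasShortcuts : Set
    HasShortcuts =
      ∀ {x x′ y y′ z} → x ∈ S → y ∈ S → z ∈ S →
      (e : Adj x x′) (p : Walk G x′ y) (f : Adj y y′) (q : Walk G y′ z) →
      Σ[ r ∈ Walk G x z ] walkLength G r < walkLength G (e ◅ p) + walkLength G (f ◅ q)

    -- More than two elements of `S` on a geodesic yield three successive visits, with the remaining
    -- count falling through 2, 1 and 0. A shortcut between the outer two contradicts the minimality
    -- of that segment.
    shortcuts⇒generalPosition : HasShortcuts → InGeneralPosition G S
    shortcuts⇒generalPosition shortcut w geodesic = ≮⇒≥ (absurd w geodesic)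
      where
      absurd : ∀ {u v} (w : Walk G u v) → IsGeodesic G w → ¬ 2 < ∣ S ∩ vertexSet G w ∣
      absurd w geodesic 2< with firstVisit w 2<
      ... | visit p₀ p x∈S 1< with nextVisit p 1<
      ... | visit e p₁ p′ y∈S 0< with nextVisit p′ 0<
      ... | visit f p₂ p₃ z∈S _ =
        let middle = (e ◅ p₁) ◅◅ (f ◅ p₂)
            r , r< = shortcut x∈S y∈S z∈S e p₁ f p₂
            -- Reassociation makes the part from the first visit to the third the single factor
            -- `middle`.
            geodesic′ = subst (λ q → IsGeodesic G (p₀ ◅◅ q))
                              (sym (◅◅-assoc (e ◅ p₁) (f ◅ p₂) p₃)) geodesic
        in <⇒≱ (subst (walkLength G r <_) (sym (walkLength-◅◅ (e ◅ p₁) (f ◅ p₂))) r<)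
               (geodesic-segment-shortest p₀ middle p₃ geodesic′ r)

    clique⇒generalPosition : IsClique G S → InGeneralPosition G S
    clique⇒generalPosition clique = shortcuts⇒generalPosition shortcut
      where
      shortcut : HasShortcuts
      shortcut {x} {z = z} x∈S _ z∈S e p f q with x ≟ z
      -- `HasShortcuts` lets `x` and `z` coincide, and then the empty walk is shorter.
      ... | yes refl = ε , z<s
      ... | no x≢z = clique x∈S z∈S x≢z ◅ ε , s≤s (m≤n⇒m≤o+n (walkLength G p) (s≤s z≤n))

    independent⇒generalPosition : IsIndependent G S → ∀ {c} → (∀ {x} → x ∈ S → Adj c x) →
                                  InGeneralPosition G S
    independent⇒generalPosition independent {c} c~S = shortcuts⇒generalPosition shortcut
      where
      shortcut : HasShortcuts
      -- A half consisting of one edge would join two vertices of `S`. Hence each half has at least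
      -- two edges, and the walk through `c` has only two in total.
      shortcut x∈S y∈S _ e ε _ _ = contradiction e (independent x∈S y∈S)
      shortcut _ y∈S z∈S _ (_ ◅ _) f ε = contradiction f (independent y∈S z∈S)
      shortcut x∈S _ z∈S e (_ ◅ p) f (_ ◅ q) =
        Adj-sym (c~S x∈S) ◅ c~S z∈S ◅ ε ,
        s≤s (s≤s (m≤n⇒m≤o+n (walkLength G p) (s≤s z≤n)))

  -- Degrees

  neighbours : Fin n → Subset n
  neighbours v = Vec.tabulate (does ∘ adj? v)

  ∈-neighbours⁻ : ∀ {v x} → x ∈ neighbours v → Adj v x
  ∈-neighbours⁻ {v} {x} x∈
    with adj? v x | trans (sym (lookup∘tabulate (does ∘ adj? v) x)) ([]=⇒lookup x∈)
  ... | yes vx | _ = vx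
  ... | no _   | ()

  cone-clique : ∀ {S v} → IsClique G S → S ⊆ neighbours v → IsClique G (⁅ v ⁆ ∪ S)
  cone-clique {S} {v} clique S⊆N {x} {y} x∈ y∈ x≢y with x∈p∪q⁻ ⁅ v ⁆ S x∈ | x∈p∪q⁻ ⁅ v ⁆ S y∈
  ... | inj₂ x∈S | inj₂ y∈S = clique x∈S y∈S x≢y
  ... | inj₁ x∈v | inj₂ y∈S rewrite x∈⁅y⁆⇒x≡y v x∈v = ∈-neighbours⁻ (S⊆N y∈S)
  ... | inj₂ x∈S | inj₁ y∈v rewrite x∈⁅y⁆⇒x≡y v y∈v = Adj-sym (∈-neighbours⁻ (S⊆N x∈S))
  ... | inj₁ x∈v | inj₁ y∈v =
    contradiction (trans (x∈⁅y⁆⇒x≡y v x∈v) (sym (x∈⁅y⁆⇒x≡y v y∈v))) x≢y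

  induced : (p : Subset n) → Graph ∣ p ∣
  induced p = record
    { Adj    = λ i j → Adj (element p i) (element p j)
    ; adj?   = λ i j → adj? (element p i) (element p j)
    ; sym    = Adj-sym
    ; irrefl = irrefl ∘ cong (element p)
    }

  image-clique : ∀ p {S} → IsClique (induced p) S → IsClique G (image p S)
  image-clique p {S} clique x∈ y∈ x≢y
    with i , i∈S , refl ← ∈-image⁻ p S x∈ | j , j∈S , refl ← ∈-image⁻ p S y∈
    = clique i∈S j∈S (x≢y ∘ cong (element p))

  image-independent : ∀ p {S} → IsIndependent (induced p) S → IsIndependent G (image p S)
  image-independent p {S} independent x∈ y∈
    with i , i∈S , refl ← ∈-image⁻ p S x∈ | j , j∈S , refl ← ∈-image⁻ p S y∈
    = independent i∈S j∈S

  degree<ramsey : ∀ {a R} → IsGPNumber G a → IsRamseyNumber a (a + 1) R →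
                  ∀ v → ∣ neighbours v ∣ < R
  degree<ramsey {a} (_ , gp≤a) (ramsey , _) v = ≰⇒> absurd
    where
    gp-bound : ∀ S → InGeneralPosition G S → ∣ S ∣ ≤ a
    gp-bound S gp = gp≤a _ (S , refl , gp)

    absurd : ¬ _ ≤ ∣ neighbours v ∣
    absurd R≤ with P , P⊆N , refl ← subset-of-size _ (neighbours v) R≤ with ramsey (induced P)
    -- Adding `v`, which is not its own neighbour, raises the order of the clique from `a` to more
    -- than `a`.
    ... | inj₁ (S , refl , clique) =
      <⇒≱ (subst (_< ∣ ⁅ v ⁆ ∪ image P S ∣) (∣image∣ P S) (x∉p⇒∣p∣<∣⁅x⁆∪p∣ v∉S))
          (gp-bound (⁅ v ⁆ ∪ image P S)
            (clique⇒generalPosition _ (cone-clique (image-clique P clique) S⊆N)))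
      where
      S⊆N : image P S ⊆ neighbours v
      S⊆N = P⊆N ∘ image⊆ P S
      v∉S : v ∉ image P S
      v∉S v∈S = irrefl refl (∈-neighbours⁻ (S⊆N v∈S))
    -- The independent set alone exceeds `a`; here `v` serves as the common neighbour `c`.
    ... | inj₂ (S , ∣S∣≡a+1 , independent) =
      <⇒≱ (≤-reflexive (trans (+-comm 1 a) (sym (trans (∣image∣ P S) ∣S∣≡a+1))))
          (gp-bound (image P S)
            (independent⇒generalPosition _ (image-independent P independent)
              (∈-neighbours⁻ ∘ P⊆N ∘ image⊆ P S)))

  -- One copy of `size G` counts each edge at its smaller end, the other, after flipping, at its
  -- larger end. At each vertex the two counts concern disjoint sets of neighbours, so their sum is
  -- at most the degree.
  handshake-≤ : ∀ {d} → (∀ v → ∣ neighbours v ∣ ≤ d) → size G * 2 ≤ d * n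
  handshake-≤ {d} degree≤d = begin
    size G * 2
      ≡⟨ *-comm (size G) 2 ⟩
    size G + (size G + 0)
      ≡⟨ cong₂ _+_ refl (+-identityʳ (size G)) ⟩
    size G + size G
      ≡⟨ cong₂ _+_ size≡ (trans size≡ (sum-related-flip up? vs vs)) ⟩
    sum (List.map (#related up? vs) vs) + sum (List.map (#related (flip up?) vs) vs)
      ≡⟨ sum-map-+ _ _ vs ⟩
    sum (List.map (λ v → #related up? vs v + #related (flip up?) vs v) vs)
      ≤⟨ sum-map-≤ (λ v → ≤-trans (up+down≤degree v) (degree≤d v)) vs ⟩
    length vs * d
      ≡⟨ cong (_* d) (length-tabulate {n = n} id) ⟩
    n * d
      ≡⟨ *-comm n d ⟩
    d * n ∎
    where
    open ≤-Reasoning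
    vs = allFin n
    Up : Fin n → Fin n → Set
    Up i j = i Fin.< j × Adj i j
    up? : ∀ i → U.Decidable (Up i)
    up? i j = (i <? j) ×-dec adj? i j
    size≡ : size G ≡ sum (List.map (#related up? vs) vs)
    size≡ = length-filter-cartesianProduct up? vs vs
    up+down≤degree : ∀ v → #related up? vs v + #related (flip up?) vs v ≤ ∣ neighbours v ∣
    up+down≤degree v = ≤-trans
      (length-filter-disjoint (up? v) (flip up? v) (adj? v) proj₂ (Adj-sym ∘ proj₂)
        (λ (v<w , _) (w<v , _) → <-asym v<w w<v) vs)
      (≤-reflexive (sym (∣tabulate∣ (adj? v) id)))

-- The bound over the rationals

-- Passing to unnormalised rationals makes the claim a cross-multiplied integer inequality. `mkℚᵘ`
-- stores the denominator minus one, so its arguments 0 and 1 stand for the denominators 1 and 2.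
half-bound : ∀ m r n → m * 2 ≤ r * n → ((+ m) / 1) ≤ℚ (((+ r) / 2) *ℚ ((+ n) / 1))
half-bound m r n m*2≤r*n = toℚᵘ-cancel-≤ (begin
  ℚ.toℚᵘ ((+ m) / 1)
    ≃⟨ toℚᵘ-fromℚᵘ (mkℚᵘ (+ m) 0) ⟩
  mkℚᵘ (+ m) 0
    ≤⟨ *≤* cross ⟩
  mkℚᵘ (+ r) 1 ℚᵘ.* mkℚᵘ (+ n) 0
    ≃⟨ ℚᵘ.*-cong (toℚᵘ-fromℚᵘ (mkℚᵘ (+ r) 1)) (toℚᵘ-fromℚᵘ (mkℚᵘ (+ n) 0)) ⟨
  ℚ.toℚᵘ ((+ r) / 2) ℚᵘ.* ℚ.toℚᵘ ((+ n) / 1)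
    ≃⟨ toℚᵘ-homo-* ((+ r) / 2) ((+ n) / 1) ⟨
  ℚ.toℚᵘ (((+ r) / 2) *ℚ ((+ n) / 1)) ∎)
  where
  open ℚᵘ.≤-Reasoning
  cross : (+ m) ℤ.* (+ 2) ℤ.≤ ((+ r) ℤ.* (+ n)) ℤ.* (+ 1)
  cross rewrite ℤ.*-identityʳ ((+ r) ℤ.* (+ n)) | sym (ℤ.pos-* m 2) | sym (ℤ.pos-* r n) =
    ℤ.+≤+ m*2≤r*n

theorem3p7 : ∀ (a n : ℕ) → 3 ≤ a → a ≤ n →
    ∀ (gex R : ℕ) → IsGex n a gex → IsRamseyNumber a (a + 1) R →
    ((+ gex) / 1) ≤ℚ (((+ R - 1ℤ) / 2) *ℚ ((+ n) / 1))
theorem3p7 _ zero 3≤a a≤n _ _ _ _ = contradiction (≤-trans 3≤a a≤n) n≮0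
-- The value `R = 0`, for which `+ R - 1ℤ` would be negative, is excluded because the vertex `zero`
-- would have degree below 0.
theorem3p7 _ (suc _) _ _ _ zero ((G , gp , _) , _) ramsey =
  contradiction (degree<ramsey G gp ramsey zero) n≮0
-- For `R = suc r` the numerator `+ R - 1ℤ` computes to `+ r`, and degrees below `suc r` are at most
-- `r`.
theorem3p7 _ n@(suc _) _ _ _ (suc r) ((G , gp , refl) , _) ramsey =
  half-bound (size G) r n (handshake-≤ G (s≤s⁻¹ ∘ degree<ramsey G gp ramsey))
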